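{- Consider any circular 3G matching market of size $N=3$ (three women, three men and three dogs). Then there exists a stable matching. Furthermore, for any agent $x$ (of any of the three genders), there exists a stable matching in which either $x$ is $1$-content, or $x$'s favorite is $1$-content and $x$ is $2$-content.
   Context: A circular 3G matching market of size $N$ consists of three disjoint sets of agents (three "genders"), each of size $N$: women $a_1,\dots,a_N$, men $b_1,\dots,b_N$, and dogs $c_1,\dots,c_N$. Every woman has a strict linear preference order on the set of all $N$ men, every man has a strict linear preference order on the set of all $N$ dogs, and every dog has a strict linear preference order on the set of all $N$ women. These orders are arbitrary. The agent ranked as number $1$ by $x$ is called $x$'s favorite. A triple consists of one woman, one man and one dog. Agents compare triples containing themselves by the circular rule: a woman strictly prefers one triple to another if and only if she strictly prefers the man in the first to the man in the second; likewise, men compare triples only by the dog in them, and dogs only by the woman in them. A matching is a partition of all the agents into $N$ triples, each consisting of one woman, one man and one dog. A triple $T$ is a blocking triple for a matching if each of the three members of $T$ strictly prefers $T$ to the triple containing that member in the matching. A matching is stable if it has no blocking triple. Given a matching, an agent $x$ is $i$-content if the agent that $x$ ranks as number $i$ (among the agents of the gender $x$ cares about) belongs to the same triple of the matching as $x$. -}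

module Defs where

open import Data.Fin.Base using (Fin)
open import Data.List.Base using (allFin; filter; length)
open import Data.Nat.Base using (ℕ; suc)
open import Data.Product using (_×_; _,_; proj₁; ∃-syntax; ∃!)
open import Level using (0ℓ)
open import Relation.Binary.Core using (Rel)
open import Relation.Binary.Structures using (IsStrictTotalOrder)
open import Relation.Binary.PropositionalEquality.Core using (_≡_)
open import Relation.Nullary.Negation.Core using (¬_)

data Gender : Set where
  woman man dog : Gender

target : Gender → Gender
target woman = man
target man   = dog
target dog   = woman

Agent : ℕ → Set
Agent n = Gender × Fin n

gender : ∀ {n} → Agent n → Gender
gender = proj₁

record Preference (n : ℕ) : Set₁ where
  infix 4 _≻_
  field
    -- j ≻ k : j is strictly preferred to k
    _≻_                : Rel (Fin n) 0ℓ
    isStrictTotalOrder : IsStrictTotalOrder _≡_ _≻_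

  -- Ranks count from 1, so the best agent has rank 1 rather than 0.
  rank : Fin n → ℕ
  rank j = suc (length (filter (λ k → k ≻? j) (allFin n)))
    where open IsStrictTotalOrder isStrictTotalOrder renaming (_<?_ to _≻?_)

-- preference x is an order on the agents of gender target (gender x).
record Market (n : ℕ) : Set₁ where
  field
    preference : Agent n → Preference n

-- t g is the index of the member of gender g.
Triple : ℕ → Set
Triple n = Gender → Fin n

infix 4 _∈ᵗ_
_∈ᵗ_ : ∀ {n} → Agent n → Triple n → Set
(g , i) ∈ᵗ t = t g ≡ i

record Matching (n : ℕ) : Set where
  field
    triple    : Fin n → Triple n
    partition : ∀ (x : Agent n) → ∃! _≡_ (λ k → x ∈ᵗ triple k)

  tripleOf : Agent n → Triple n
  tripleOf x = triple (proj₁ (partition x))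

module _ {n : ℕ} (M : Market n) where
  open Market M
  open Matching

  Prefers : Agent n → Triple n → Triple n → Set
  Prefers x t u = t (target (gender x)) ≻ u (target (gender x))
    where open Preference (preference x)

  Blocking : Matching n → Triple n → Set
  Blocking μ t = ∀ (x : Agent n) → x ∈ᵗ t → Prefers x t (tripleOf μ x)

  Stable : Matching n → Set
  Stable μ = ¬ (∃[ t ] Blocking μ t)

  -- y is the agent that x ranks as number i.
  Ranks : Agent n → ℕ → Agent n → Set
  Ranks x i (g , j) = g ≡ target (gender x) × Preference.rank (preference x) j ≡ i

  Favorite : Agent n → Agent n → Set
  Favorite x y = Ranks x 1 y

  Content : Matching n → ℕ → Agent n → Set
  Content μ i x = ∃[ y ] (Ranks x i y × y ∈ᵗ tripleOf μ x)

{-# OPTIONS --safe #-}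
-- Let x ask for its favourite, that favourite for its own favourite, and so
-- on, until an agent is reached for the second time; if necessary, ask x for
-- its second choice as well.  Whatever the answers, some matching fulfils the
-- claim for x and is stable no matter how the unknown preferences are
-- completed.  There are only a few hundred sequences of answers for each x, so
-- this is decided by evaluation.
module Submission where

open import Defs
open import Data.Fin.Base using (Fin; zero; suc; fromℕ<)
open import Data.Fin.Permutation using (Permutation′; id; insert; _⟨$⟩ʳ_; _⟨$⟩ˡ_; inverseˡ; inverseʳ)
open import Data.Fin.Properties using (_≟_; any?; all?; injective⇒≤; punchOut-injective; fromℕ<-injective)
open import Data.List.Base using (List; []; _∷_; [_]; _∷ʳ_; length; filter; allFin; cartesianProductWith)
open import Data.List.Membership.Propositional using (_∈_)
open import Data.List.Membership.Propositional.Properties using (∈-allFin)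
open import Data.List.Membership.DecPropositional using (_∈?_)
open import Data.List.Properties using (filter-notAll; length-tabulate)
open import Data.List.Relation.Unary.Any as Any using (Any; here; there; satisfied)
open import Data.Nat.Base using (ℕ; zero; suc; _+_; _≤_; _<_; z≤n; s≤s)
open import Data.Nat.Properties using (_<?_; ≤∧≢⇒<; ≤-refl; ≤-reflexive; ≤-trans; m≤n⇒m≤1+n; <⇒≱; <⇒≢; <-irrefl; 1+n≰n; +-identityʳ; +-suc; m<m+n)
open import Data.Product using (_×_; _,_; ∃-syntax; proj₁; proj₂; uncurry)
open import Data.Product.Properties using (≡-dec)
open import Data.Sum.Base using (_⊎_; inj₁; inj₂; [_,_]′)
open import Data.Empty using (⊥)
open import Function.Base using (_∘_)
open import Function.Definitions using (Injective)
open import Relation.Binary.Definitions using (DecidableEquality; tri<; tri≈; tri>)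
open import Relation.Binary.PropositionalEquality using (_≡_; _≢_; refl; sym; trans; cong; subst)
open import Relation.Binary.Structures using (IsStrictTotalOrder)
open import Relation.Nullary.Decidable using (Dec; map′; yes; no; ¬?; _×-dec_; _⊎-dec_; toWitness)
open import Relation.Nullary.Negation using (¬_; contradiction)
open import Relation.Unary using (Pred; Decidable; _⊆_)

-- Ranks in a finite strict total order.

module _ {a p q} {A : Set a} {P : Pred A p} {Q : Pred A q}
         (P? : Decidable P) (Q? : Decidable Q) (P⊆Q : P ⊆ Q) where

  length-filter-mono-≤ : ∀ xs → length (filter P? xs) ≤ length (filter Q? xs)
  length-filter-mono-≤ []       = z≤n
  length-filter-mono-≤ (x ∷ xs) with P? x | Q? x
  ... | yes _  | yes _  = s≤s (length-filter-mono-≤ xs)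
  ... | yes Px | no ¬Qx = contradiction (P⊆Q Px) ¬Qx
  ... | no _   | yes _  = m≤n⇒m≤1+n (length-filter-mono-≤ xs)
  ... | no _   | no _   = length-filter-mono-≤ xs

  length-filter-mono-< : ∀ {x xs} → x ∈ xs → Q x → ¬ P x →
                         length (filter P? xs) < length (filter Q? xs)
  length-filter-mono-< {x} {_ ∷ xs} (here refl) Qx ¬Px with P? x | Q? x
  ... | yes Px | _      = contradiction Px ¬Px
  ... | no _   | no ¬Qx = contradiction Qx ¬Qx
  ... | no _   | yes _  = s≤s (length-filter-mono-≤ xs)
  length-filter-mono-< {x} {y ∷ _} (there x∈xs) Qx ¬Px with P? y | Q? y
  ... | yes _  | yes _  = s≤s (length-filter-mono-< x∈xs Qx ¬Px)
  ... | yes Py | no ¬Qy = contradiction (P⊆Q Py) ¬Qy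
  ... | no _   | yes _  = m≤n⇒m≤1+n (length-filter-mono-< x∈xs Qx ¬Px)
  ... | no _   | no _   = length-filter-mono-< x∈xs Qx ¬Px

-- Pigeonhole: if `j` is missed, punching it out of the codomain turns `f` into an injection from
-- `Fin (suc n)` to `Fin n`.
injective⇒surjective : ∀ {n} {f : Fin n → Fin n} → Injective _≡_ _≡_ f →
                       ∀ j → ∃[ i ] f i ≡ j
injective⇒surjective {suc n} {f} f-injective j with any? (λ i → f i ≟ j)
... | yes i,fi≡j = i,fi≡j
... | no ∄i      =
  contradiction (injective⇒≤ (f-injective ∘ punchOut-injective j≢f j≢f)) 1+n≰n
  where
  j≢f : ∀ {i} → j ≢ f i
  j≢f j≡fi = ∄i (_ , sym j≡fi)

module _ {n} (P : Preference n) where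
  open Preference P
  open IsStrictTotalOrder isStrictTotalOrder
    using (compare; irrefl) renaming (trans to ≻-trans; _<?_ to _≻?_)

  -- By transitivity whatever beats `j` also beats `k`, and `j` itself is counted only for `k`.
  rank-mono : ∀ {j k} → j ≻ k → rank j < rank k
  rank-mono {j} {k} j≻k =
    s≤s (length-filter-mono-< (_≻? j) (_≻? k) (λ i≻j → ≻-trans i≻j j≻k)
          (∈-allFin j) j≻k (irrefl refl))

  rank-injective : Injective _≡_ _≡_ rank
  rank-injective {j} {k} rank≡ with compare j k
  ... | tri< j≻k _ _ = contradiction rank≡ (<⇒≢ (rank-mono j≻k))
  ... | tri≈ _ j≡k _ = j≡k
  ... | tri> _ _ k≻j = contradiction (sym rank≡) (<⇒≢ (rank-mono k≻j))

  -- `j` does not beat itself, so fewer than `n` agents are counted; this absorbs the `suc` in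
  -- `rank`.
  rank≤n : ∀ j → rank j ≤ n
  rank≤n j = subst (rank j ≤_) (length-tabulate (λ i → i))
    (filter-notAll (_≻? j) (allFin n) (Any.map (λ { refl → irrefl refl }) (∈-allFin j)))

  -- Guarantees that every question has an answer. Ranks shifted down by one form an injective
  -- self-map of `Fin n`, hence a surjective one.
  rank-surjective : ∀ {i} → i < n → ∃[ j ] rank j ≡ suc i
  rank-surjective {i} i<n with injective⇒surjective position-injective (fromℕ< i<n)
    where
    position-injective : Injective _≡_ _≡_ (λ j → fromℕ< (rank≤n j))
    position-injective eq = rank-injective (cong suc (fromℕ<-injective _ _ _ _ eq))
  ... | j , eq = j , cong suc (fromℕ<-injective _ _ _ _ eq)

-- Initial segments of a ranking.

-- js lists the values that r sends to i, i + 1, ….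
data Enumerates {n} (r : Fin n → ℕ) : ℕ → List (Fin n) → Set where
  []  : ∀ {i} → Enumerates r i []
  _∷_ : ∀ {i j js} → r j ≡ i → Enumerates r (suc i) js → Enumerates r i (j ∷ js)

At : ∀ {n} → List (Fin n) → ℕ → Fin n → Set
At []       m       d = ⊥
At (j ∷ js) zero    d = d ≡ j
At (j ∷ js) (suc m) d = At js m d

at? : ∀ {n} js m (d : Fin n) → Dec (At js m d)
at? []       m       d = no λ ()
at? (j ∷ js) zero    d = d ≟ j
at? (j ∷ js) (suc m) d = at? js m d

-- Whatever the order of the agents not in js, k is not strictly preferred to d.
NoWorse : ∀ {n} → List (Fin n) → Fin n → Fin n → Set
NoWorse []       d k = d ≡ k
NoWorse (j ∷ js) d k = d ≡ j ⊎ (k ≢ j × NoWorse js d k)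

noWorse? : ∀ {n} js (d k : Fin n) → Dec (NoWorse js d k)
noWorse? []       d k = d ≟ k
noWorse? (j ∷ js) d k = d ≟ j ⊎-dec (¬? (k ≟ j) ×-dec noWorse? js d k)

module _ {n} {r : Fin n → ℕ} where

  At⇒≡ : ∀ {i js m d} → Enumerates r i js → At js m d → r d ≡ i + m
  At⇒≡ {i} {m = zero}  (eq ∷ _) refl = trans eq (sym (+-identityʳ i))
  At⇒≡ {i} {m = suc m} (_ ∷ e)  at   = trans (At⇒≡ e at) (sym (+-suc i m))

  -- The invariant `i ≤ r k` says that `k` was not passed earlier in the list. If `k` is not the
  -- head either, injectivity makes the inequality strict, and the invariant carries over to the
  -- tail.
  NoWorse⇒≤ : Injective _≡_ _≡_ r → ∀ {i js d k} → Enumerates r i js → i ≤ r k →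
              NoWorse js d k → r d ≤ r k
  NoWorse⇒≤ inj []       i≤rk refl                 = ≤-refl
  NoWorse⇒≤ inj (eq ∷ _) i≤rk (inj₁ refl)          = ≤-trans (≤-reflexive eq) i≤rk
  NoWorse⇒≤ inj (eq ∷ e) i≤rk (inj₂ (k≢j , worse)) =
    NoWorse⇒≤ inj e (≤∧≢⇒< i≤rk λ i≡rk → k≢j (inj (trans (sym i≡rk) (sym eq)))) worse

  ∈⇒< : ∀ {i js j} → Enumerates r i js → j ∈ js → r j < i + length js
  ∈⇒< {i} (eq ∷ e) (here refl) = ≤-trans (s≤s (≤-reflexive eq)) (m<m+n i (s≤s z≤n))
  ∈⇒< {i} {_ ∷ js} (_ ∷ e) (there j∈js) =
    ≤-trans (∈⇒< e j∈js) (≤-reflexive (sym (+-suc i (length js))))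

  Enumerates-∷ʳ : ∀ {i js j} → Enumerates r i js → r j ≡ i + length js →
                  Enumerates r i (js ∷ʳ j)
  Enumerates-∷ʳ {i}          []       eq = trans eq (+-identityʳ i) ∷ []
  Enumerates-∷ʳ {i} {_ ∷ js} (h ∷ e) eq = h ∷ Enumerates-∷ʳ e (trans eq (+-suc i (length js)))

-- Enumeration of matchings.

permutations : ∀ n → List (Permutation′ n)
permutations zero    = [ id ]
permutations (suc n) = cartesianProductWith (insert zero) (allFin (suc n)) (permutations n)

-- Triple k consists of woman k, man π k and dog ρ k.
matching : ∀ {n} → Permutation′ n → Permutation′ n → Matching n
matching {n} π ρ = record
  { triple    = λ k g → σ g ⟨$⟩ʳ k
  ; partition = λ (g , i) → σ g ⟨$⟩ˡ i , inverseʳ (σ g) , λ { refl → inverseˡ (σ g) }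
  }
  where
  σ : Gender → Permutation′ n
  σ woman = id
  σ man   = π
  σ dog   = ρ

matchings : ∀ n → List (Matching n)
matchings n = cartesianProductWith matching (permutations n) (permutations n)

partner : ∀ {n} → Matching n → Agent n → Fin n
partner μ x = Matching.tripleOf μ x (target (gender x))

-- Partial knowledge of preferences and the search by questions.

_≟ᵍ_ : DecidableEquality Gender
woman ≟ᵍ woman = yes refl
woman ≟ᵍ man   = no λ ()
woman ≟ᵍ dog   = no λ ()
man   ≟ᵍ woman = no λ ()
man   ≟ᵍ man   = yes refl
man   ≟ᵍ dog   = no λ ()
dog   ≟ᵍ woman = no λ ()
dog   ≟ᵍ man   = no λ ()
dog   ≟ᵍ dog   = yes refl

_≟ᵃ_ : ∀ {n} → DecidableEquality (Agent n)
_≟ᵃ_ = ≡-dec _≟ᵍ_ _≟_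

-- The known initial segment of each agent's preference list.
Knowledge : ℕ → Set
Knowledge n = Agent n → List (Fin n)

-- Each agent reveals its choices in order of rank, so a new answer goes at the end.
learn : ∀ {n} → Knowledge n → Agent n → Fin n → Knowledge n
learn K y j z with y ≟ᵃ z
... | yes _ = K z ∷ʳ j
... | no _  = K z

module _ {n : ℕ} where

  Declines : Knowledge n → Matching n → Agent n → Fin n → Set
  Declines K μ y l = NoWorse (K y) (partner μ y) l

  -- Each triple has a member for whom the known answers alone rule out preferring it. Unlike
  -- stability, this can be decided before the preferences are complete.
  Unblocked : Knowledge n → Matching n → Set
  Unblocked K μ = ∀ i j k →
    Declines K μ (woman , i) j ⊎ Declines K μ (man , j) k ⊎ Declines K μ (dog , k) i

  unblocked? : ∀ K μ → Dec (Unblocked K μ)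
  unblocked? K μ = all? λ i → all? λ j → all? λ k →
    noWorse? (K (woman , i)) _ j ⊎-dec
    noWorse? (K (man , j)) _ k ⊎-dec
    noWorse? (K (dog , k)) _ i

module _ {n} (x : Agent n) where

  -- The claim for `x` read off from known answers. List positions count from 0, so 0 and 1 stand
  -- for ranks 1 and 2.
  Fulfilled : Knowledge n → Matching n → Set
  Fulfilled K μ =
    At (K x) 0 (partner μ x) ⊎
    ((∃[ j ] (At (K x) 0 j × At (K (favorite j)) 0 (partner μ (favorite j)))) ×
     At (K x) 1 (partner μ x))
    where
    favorite : Fin n → Agent n
    favorite j = target (gender x) , j

  fulfilled? : ∀ K μ → Dec (Fulfilled K μ)
  fulfilled? K μ =
    at? (K x) 0 _ ⊎-dec
    (any? (λ j → at? (K x) 0 j ×-dec at? (K (target (gender x) , j)) 0 _) ×-dec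
     at? (K x) 1 _)

  -- The chain of favourites is followed to y; once it closes, x is asked again.
  asked : Knowledge n → Agent n → Agent n
  asked K y with K y
  ... | []    = y
  ... | _ ∷ _ = x

  Resolved : Knowledge n → Set
  Resolved K = Any (λ μ → Fulfilled K μ × Unblocked K μ) (matchings n)

  resolved? : ∀ K → Dec (Resolved K)
  resolved? K = Any.any? (λ μ → fulfilled? K μ ×-dec unblocked? K μ) (matchings n)

  -- At most m further answers lead from K to a suitable matching.
  data Settled : ℕ → Knowledge n → Agent n → Set where
    resolved : ∀ {m K y} → Resolved K → Settled m K y
    ask      : ∀ {m K y} → let z = asked K y in
               length (K z) < n →
               (∀ j → j ∈ K z ⊎ Settled m (learn K z j) (target (gender z) , j)) →
               Settled (suc m) K y

  settled? : ∀ m K y → Dec (Settled m K y)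
  settled? zero    K y = map′ resolved (λ { (resolved r) → r }) (resolved? K)
  settled? (suc m) K y = let z = asked K y in
    map′ [ resolved , uncurry ask ]′ (λ { (resolved r) → inj₁ r ; (ask l f) → inj₂ (l , f) })
      -- Testing `resolved?` first cuts a branch as soon as the known answers suffice, which keeps
      -- the search small.
      (resolved? K ⊎-dec
       (length (K z) <? n ×-dec
        all? (λ j → _∈?_ _≟_ j (K z) ⊎-dec settled? m (learn K z j) (target (gender z) , j))))

ignorance : ∀ {n} → Knowledge n
ignorance _ = []

-- Soundness of the search for an actual market.

module _ {n} (M : Market n) where
  open Market M
  open Preference using (rank)

  Correct : Knowledge n → Set
  Correct K = ∀ y → Enumerates (rank (preference y)) 1 (K y)

  learn-correct : ∀ {K} → Correct K → ∀ {y j} →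
                  rank (preference y) j ≡ suc (length (K y)) → Correct (learn K y j)
  learn-correct correct {y} eq z with y ≟ᵃ z
  ... | yes refl = Enumerates-∷ʳ (correct y) eq
  ... | no _     = correct z

  Suitable : Agent n → Matching n → Set
  Suitable x μ =
    Stable M μ ×
    (Content M μ 1 x ⊎
     ((∃[ y ] (Favorite M x y × Content M μ 1 y)) × Content M μ 2 x))

  module _ {K} (correct : Correct K) where

    declines : ∀ y {d k} → NoWorse (K y) d k → ¬ Preference._≻_ (preference y) k d
    declines y noWorse k≻d = <⇒≱ (rank-mono (preference y) k≻d)
      (NoWorse⇒≤ (rank-injective (preference y)) (correct y) (s≤s z≤n) noWorse)

    unblocked⇒stable : ∀ μ → Unblocked K μ → Stable M μ
    unblocked⇒stable μ unblocked (t , blocking)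
      with unblocked (t woman) (t man) (t dog)
    ... | inj₁ d        = declines (woman , t woman) d (blocking _ refl)
    ... | inj₂ (inj₁ d) = declines (man , t man) d (blocking _ refl)
    ... | inj₂ (inj₂ d) = declines (dog , t dog) d (blocking _ refl)

    content : ∀ μ y {m} → At (K y) m (partner μ y) → Content M μ (suc m) y
    content μ y at = _ , (refl , At⇒≡ (correct y) at) , refl

    resolved⇒suitable : ∀ {x} → Resolved x K → ∃[ μ ] Suitable x μ
    resolved⇒suitable {x} r with satisfied r
    ... | μ , inj₁ first , unblocked =
      μ , unblocked⇒stable μ unblocked , inj₁ (content μ x first)
    ... | μ , inj₂ ((j , fav , first) , second) , unblocked =
      μ , unblocked⇒stable μ unblocked ,
      inj₂ ((_ , (refl , At⇒≡ (correct x) fav) , content μ _ first) , content μ x second)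

  -- `Settled` is a strategy against all possible answers; the market `M` selects the branch by
  -- giving its true answers, so the knowledge stays correct down to a resolved leaf.
  settled⇒suitable : ∀ x m {K y} → Correct K → Settled x m K y → ∃[ μ ] Suitable x μ
  settled⇒suitable x m correct (resolved r) = resolved⇒suitable correct r
  settled⇒suitable x (suc m) {K} {y} correct (ask incomplete answers)
    with j , eq ← rank-surjective (preference (asked x K y)) incomplete
    with answers j
  -- A repeated answer is impossible: listed agents have ranks at most `length (K z)` for the asked
  -- agent `z`, while `j` has the next rank.
  ... | inj₁ j∈ = contradiction (∈⇒< (correct _) j∈) (<-irrefl eq)
  ... | inj₂ s  = settled⇒suitable x m (learn-correct correct eq) s

-- The bound 10 allows for the favourites of all nine agents and one second choice.
settled : (x : Agent 3) → Settled x 10 ignorance x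
-- The type of `_` reduces to the unit type once the type checker has evaluated the decision to
-- `yes`.
settled (woman , i) = toWitness {a? = all? λ i → settled? (woman , i) 10 ignorance (woman , i)} _ i
settled (man   , i) = toWitness {a? = all? λ i → settled? (man   , i) 10 ignorance (man   , i)} _ i
settled (dog   , i) = toWitness {a? = all? λ i → settled? (dog   , i) 10 ignorance (dog   , i)} _ i

theorem7 : (M : Market 3) →
    (∃[ μ ] Stable M μ) ×
    ((x : Agent 3) →
      ∃[ μ ] (Stable M μ ×
              (Content M μ 1 x ⊎
               ((∃[ y ] (Favorite M x y × Content M μ 1 y)) × Content M μ 2 x))))
theorem7 M = (proj₁ some , proj₁ (proj₂ some)) , suitable
  where
  suitable : ∀ x → ∃[ μ ] Suitable M x μ
  suitable x = settled⇒suitable M x 10 (λ _ → []) (settled x)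
  -- Plain existence follows from the claim for any one agent; this choice is arbitrary.
  some = suitable (woman , zero)
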